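{- If a $\Lambda$-structure over $T$ is one-step compact, then it has quasi-ultraproducts: for every set $I$, every family $(C_i)_{i\in I}=(X_i,\xi_i)_{i\in I}$ of $T$-coalgebras with nonempty carriers and every ultrafilter $\mathfrak U$ on $I$, there exists a quasi-ultraproduct of the $C_i$ for $\mathfrak U$.
   Context: $\Lambda$ is a set of unary modal operators. A $\Lambda$-structure is a functor $T:\mathsf{Set}\to\mathsf{Set}$ with, for each $\heartsuit\in\Lambda$, maps $\llbracket\heartsuit\rrbracket_X:\mathcal P(X)\to\mathcal P(TX)$ for all sets $X$, natural: $(Tf)^{ -1}[\llbracket\heartsuit\rrbracket_Y(B)]=\llbracket\heartsuit\rrbracket_X(f^{ -1}[B])$ for $f:X\to Y$, $B\subseteq Y$. A $T$-coalgebra is a pair $(X,\xi)$ with $\xi:X\to TX$. For a family $\mathcal S\subseteq\mathcal P(X)$, $\mathsf{Prop}(\Lambda(\mathcal S))$ is the set of Boolean combinations of formal expressions $\heartsuit A$ with $\heartsuit\in\Lambda$, $A\in\mathcal S$ (one-step formulas over $X$). For $t\in TX$, $t\models\heartsuit A$ iff $t\in\llbracket\heartsuit\rrbracket_X(A)$, extended to Boolean combinations as usual. A set of one-step formulas over $X$ is satisfiable if some $t\in TX$ satisfies all its members. The structure is one-step compact if for every set $X$, every $\Phi\subseteq\mathsf{Prop}(\Lambda(\mathcal P(X)))$ all of whose finite subsets are satisfiable is satisfiable. The ultraproduct of nonempty sets $X_i$ is $\prod_{\mathfrak U}X_i=(\prod_{i\in I}X_i)/{\sim}$ with $x\sim y$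 iff $\{i\mid x_i=y_i\}\in\mathfrak U$; elements are written as representatives $x=(x_i)$. For $A_i\subseteq X_i$, $\prod_{\mathfrak U}A_i:=\{x\in\prod_{\mathfrak U}X_i\mid\{i\mid x_i\in A_i\}\in\mathfrak U\}$. A coalgebra $\xi:X\to TX$ on $X=\prod_{\mathfrak U}X_i$ is a quasi-ultraproduct of the $C_i=(X_i,\xi_i)$ if for every family $(A_i)$ of subsets $A_i\subseteq X_i$, every $x\in X$ and every $\heartsuit\in\Lambda$: $\xi(x)\in\llbracket\heartsuit\rrbracket_X(\prod_{\mathfrak U}A_i)\iff\{i\in I\mid\xi_i(x_i)\in\llbracket\heartsuit\rrbracket_{X_i}(A_i)\}\in\mathfrak U$. -}

module Defs where

open import Level using (suc)
open import Data.Empty.Polymorphic using (⊥)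
open import Data.List.Membership.Propositional using () renaming (_∈_ to _∈ᴸ_)
open import Data.List.Relation.Unary.All using (All)
open import Data.Product.Base using (_×_; _,_; ∃)
open import Data.Sum.Base using (_⊎_)
open import Data.Unit.Polymorphic using (⊤)
open import Function.Bundles using (Func; _⟨$⟩_; _⇔_)
open import Function.Definitions using (StrictlySurjective; StrictlyInverseˡ)
import Function.Construct.Composition as Composition
import Function.Construct.Identity as Identity
import Function.Relation.Binary.Setoid.Equality as FuncEquality
open import Relation.Binary.Bundles using (Setoid)
open import Relation.Binary.Definitions using (_Respects_)
open import Relation.Nullary.Negation.Core using (¬_)
open import Relation.Unary using (Pred; _∈_; _∉_; _⊆_; _≐_; _∩_; ∁)
open import Relation.Unary.Polymorphic using (U; ∅)

open Setoid using (Carrier)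

-- Sets with possibly non-trivial equality are setoids, functions between them
-- are `Func`, and quotients are formed by changing the equality relation.
-- Bare index sets are plain types.

-- Every surjection between sets splits.  The section has to respect equality,
-- so this is the axiom of choice of set theory, which Agda does not prove, and
-- not the provable type-theoretic one.

AxiomOfChoice : ∀ ℓ → Set (suc ℓ)
AxiomOfChoice ℓ = {A B : Setoid ℓ ℓ} (f : Func A B) →
  StrictlySurjective (Setoid._≈_ B) (f ⟨$⟩_) →
  ∃ λ (g : Func B A) → StrictlyInverseˡ (Setoid._≈_ B) (f ⟨$⟩_) (g ⟨$⟩_)

record Subset {ℓ} (X : Setoid ℓ ℓ) : Set (suc ℓ) where
  field
    pred     : Pred (Carrier X) ℓ
    respects : pred Respects (Setoid._≈_ X)

open Subset public

𝒫 : ∀ {ℓ} → Setoid ℓ ℓ → Setoid (suc ℓ) ℓ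
𝒫 X = record
  { Carrier = Subset X
  ; _≈_ = λ A B → pred A ≐ pred B
  ; isEquivalence = record
    { refl  = (λ p → p) , (λ p → p)
    ; sym   = λ (p , q) → q , p
    ; trans = λ (p , q) (r , s) → (λ a → r (p a)) , (λ c → q (s c))
    }
  }

preimage : ∀ {ℓ} {X Y : Setoid ℓ ℓ} → Func X Y → Subset Y → Subset X
preimage f B = record
  { pred     = λ x → (f ⟨$⟩ x) ∈ pred B
  ; respects = λ x≈y → respects B (Func.cong f x≈y)
  }

record Endofunctor ℓ : Set (suc ℓ) where
  field
    T₀ : Setoid ℓ ℓ → Setoid ℓ ℓ
    T₁ : ∀ {X Y} → Func X Y → Func (T₀ X) (T₀ Y)
    T-resp-≈ : ∀ {X Y} {f g : Func X Y} → FuncEquality._≈_ X Y f g →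
               FuncEquality._≈_ (T₀ X) (T₀ Y) (T₁ f) (T₁ g)
    T-id : ∀ {X} →
           FuncEquality._≈_ (T₀ X) (T₀ X) (T₁ (Identity.function X)) (Identity.function (T₀ X))
    T-∘ : ∀ {X Y Z} (f : Func X Y) (g : Func Y Z) →
          FuncEquality._≈_ (T₀ X) (T₀ Z)
            (T₁ (Composition.function f g)) (Composition.function (T₁ f) (T₁ g))

record Structure {ℓ} (Λ : Set ℓ) : Set (suc ℓ) where
  field
    functor : Endofunctor ℓ

  open Endofunctor functor public

  field
    ⟦_⟧ : Λ → (X : Setoid ℓ ℓ) → Func (𝒫 X) (𝒫 (T₀ X))
    natural : ∀ ♥ {X Y} (f : Func X Y) (B : Subset Y) →
      pred (preimage (T₁ f) (⟦ ♥ ⟧ Y ⟨$⟩ B)) ≐ pred (⟦ ♥ ⟧ X ⟨$⟩ preimage f B)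

module _ {ℓ} {Λ : Set ℓ} (S : Structure Λ) where

  open Structure S

  -- Prop(Λ(𝒫 X)): `atom ♥ A` is the formal expression ♥A.

  data OneStepFormula (X : Setoid ℓ ℓ) : Set (suc ℓ) where
    atom      : Λ → Subset X → OneStepFormula X
    ⊤ᶠ ⊥ᶠ     : OneStepFormula X
    ¬ᶠ_       : OneStepFormula X → OneStepFormula X
    _∧ᶠ_ _∨ᶠ_ : OneStepFormula X → OneStepFormula X → OneStepFormula X

  _⊨_ : ∀ {X} → Carrier (T₀ X) → OneStepFormula X → Set ℓ
  _⊨_ {X} t (atom ♥ A) = t ∈ pred (⟦ ♥ ⟧ X ⟨$⟩ A)
  t ⊨ ⊤ᶠ       = ⊤
  t ⊨ ⊥ᶠ       = ⊥
  t ⊨ (¬ᶠ φ)   = ¬ (t ⊨ φ)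
  t ⊨ (φ ∧ᶠ ψ) = (t ⊨ φ) × (t ⊨ ψ)
  t ⊨ (φ ∨ᶠ ψ) = (t ⊨ φ) ⊎ (t ⊨ ψ)

  Satisfiable : ∀ {X} → Pred (OneStepFormula X) (suc ℓ) → Set (suc ℓ)
  Satisfiable {X} Φ = ∃ λ (t : Carrier (T₀ X)) → ∀ φ → φ ∈ Φ → t ⊨ φ

  -- Finite subsets are enumerated by lists.  Φ need not be closed under
  -- replacing A by an equal subset in ♥A; since ⊨ is invariant under this
  -- replacement, closing Φ under it changes no satisfiability.

  OneStepCompact : Set (suc (suc ℓ))
  OneStepCompact = ∀ (X : Setoid ℓ ℓ) (Φ : Pred (OneStepFormula X) (suc ℓ)) →
    (∀ φs → All (_∈ Φ) φs → Satisfiable (_∈ᴸ φs)) → Satisfiable Φ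

  record Coalgebra : Set (suc ℓ) where
    field
      X : Setoid ℓ ℓ
      ξ : Func X (T₀ X)

record Ultrafilter {ℓ} (I : Set ℓ) : Set (suc ℓ) where
  field
    sets   : Pred (Pred I ℓ) ℓ
    full   : U ∈ sets
    proper : ∅ ∉ sets
    upward : ∀ {J K} → J ⊆ K → J ∈ sets → K ∈ sets
    meet   : ∀ {J K} → J ∈ sets → K ∈ sets → (J ∩ K) ∈ sets
    ultra  : ∀ J → J ∈ sets ⊎ ∁ J ∈ sets

module _ {ℓ} {I : Set ℓ} (𝔘 : Ultrafilter I) where

  open Ultrafilter 𝔘

  Ultraproduct : (I → Setoid ℓ ℓ) → Setoid ℓ ℓ
  Ultraproduct X = record
    { Carrier = ∀ i → Carrier (X i)
    ; _≈_ = λ x y → (λ i → Setoid._≈_ (X i) (x i) (y i)) ∈ sets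
    ; isEquivalence = record
      { refl  = upward (λ {i} _ → Setoid.refl (X i)) full
      ; sym   = upward (λ {i} → Setoid.sym (X i))
      ; trans = λ p q → upward (λ {i} (r , s) → Setoid.trans (X i) r s) (meet p q)
      }
    }

  ultraproductSubset : {X : I → Setoid ℓ ℓ} → (∀ i → Subset (X i)) → Subset (Ultraproduct X)
  ultraproductSubset A = record
    { pred     = λ x → (λ i → x i ∈ pred (A i)) ∈ sets
    ; respects = λ x≈y p → upward (λ {i} (r , a) → respects (A i) r a) (meet x≈y p)
    }

  module _ {Λ : Set ℓ} (S : Structure Λ) (C : I → Coalgebra S) where

    open Structure S
    open module C i = Coalgebra (C i)

    IsQuasiUltraproduct : Func (Ultraproduct X) (T₀ (Ultraproduct X)) → Set (suc ℓ)
    IsQuasiUltraproduct ζ =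
      ∀ (A : ∀ i → Subset (X i)) (x : Carrier (Ultraproduct X)) (♥ : Λ) →
      (ζ ⟨$⟩ x) ∈ pred (⟦ ♥ ⟧ (Ultraproduct X) ⟨$⟩ ultraproductSubset A)
        ⇔
      (λ i → (ξ i ⟨$⟩ x i) ∈ pred (⟦ ♥ ⟧ (X i) ⟨$⟩ A i)) ∈ sets

    -- The carrier is fixed to be the ultraproduct; only its structure map is
    -- asserted to exist.

    QuasiUltraproduct : Set (suc ℓ)
    QuasiUltraproduct = ∃ IsQuasiUltraproduct

HasQuasiUltraproducts : ∀ {ℓ} {Λ : Set ℓ} → Structure Λ → Set (suc ℓ)
HasQuasiUltraproducts {ℓ} S =
  ∀ (I : Set ℓ) (C : I → Coalgebra S) → (∀ i → Carrier (Coalgebra.X (C i))) →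
  (𝔘 : Ultrafilter I) → QuasiUltraproduct 𝔘 S C

{-# OPTIONS --safe #-}

-- For a point x of the ultraproduct, let Φ x consist of the formulas ♥(∏A) for
-- which ξᵢ(xᵢ) ∈ ⟦♥⟧Aᵢ holds 𝔘-almost everywhere and of ¬♥(∏A) for the other
-- families A.  A finite part of Φ x mentions only finitely many families A; for
-- 𝔘-almost every i there is a map f : Xᵢ → ∏X with f⁻¹(∏A) = Aᵢ for each of
-- them, so by naturality T f (ξᵢ(xᵢ)) satisfies this part once i also
-- satisfies the finitely many required membership conditions.  One-step
-- compactness then yields a point satisfying Φ x, and choosing a representative
-- of every class of the ultraproduct makes the choice of this point respect
-- equality.
module Submission where

open import Defs
open import Axiom.ExcludedMiddle using (ExcludedMiddle)

open import Data.Bool.Base using (Bool; true; false)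
open import Data.Fin.Base using (Fin; zero; suc)
open import Data.List.Base using (lookup)
open import Data.List.Relation.Unary.All as All using (All)
open import Data.List.Relation.Unary.Any using (index)
open import Data.List.Relation.Unary.Any.Properties using (lookup-index)
open import Data.List.Membership.Propositional using () renaming (_∈_ to _∈ᴸ_)
open import Data.List.Membership.Propositional.Properties using (∈-lookup)
open import Data.Nat.Base using (zero; suc)
open import Data.Product.Base using (_,_; ∃; proj₁; proj₂)
open import Data.Sum.Base using (inj₁; inj₂; [_,_]′)
open import Data.Vec.Base as Vec using (Vec; []; _∷_; tabulate)
open import Data.Vec.Properties using (lookup∘tabulate; tabulate-cong)
open import Function.Base using (_∘_; id)
open import Function.Bundles using (Func; _⟨$⟩_; mk⇔)
import Function.Construct.Composition as Composition
import Level
open import Relation.Binary.Bundles using (Setoid)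
open import Relation.Binary.PropositionalEquality
  using (_≡_; refl; sym; trans; cong; subst; setoid)
open import Relation.Nullary.Decidable.Core using (Dec; yes; no; does)
open import Relation.Nullary.Decidable using (does-⇔)
open import Relation.Nullary.Negation.Core using (contradiction)
open import Relation.Unary using (Pred; _∈_; _∉_; _≐_; ∁)

open Setoid using (Carrier)

does-≡⇒→ : ∀ {p q} {P : Set p} {Q : Set q} (P? : Dec P) (Q? : Dec Q) →
           does P? ≡ does Q? → P → Q
does-≡⇒→ _        (yes q) _ _ = q
does-≡⇒→ (no ¬p)  (no _)  _ p = contradiction p ¬p

module _ {ℓ} {I : Set ℓ} (𝔘 : Ultrafilter I) where

  open Ultrafilter 𝔘

  meet-Fin : ∀ {n} (J : Fin n → Pred I ℓ) → (∀ k → J k ∈ sets) →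
             (λ i → ∀ k → i ∈ J k) ∈ sets
  meet-Fin {zero}  J p = upward (λ _ ()) full
  meet-Fin {suc n} J p =
    upward (λ { (q , _) zero → q ; (_ , r) (suc k) → r k })
           (meet (p zero) (meet-Fin (J ∘ suc) (p ∘ suc)))

  -- Splitting the patterns by their first bit reduces an intersection over all of them to finitely
  -- many binary meets.
  meet-Vec : ∀ {n} (J : Vec Bool n → Pred I ℓ) → (∀ σ → J σ ∈ sets) →
             (λ i → ∀ σ → i ∈ J σ) ∈ sets
  meet-Vec {zero}  J p = upward (λ { q [] → q }) (p [])
  meet-Vec {suc n} J p =
    upward (λ { (q , _) (true ∷ σ) → q σ ; (_ , r) (false ∷ σ) → r σ })
           (meet (meet-Vec (J ∘ (true ∷_)) (p ∘ (true ∷_)))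
                 (meet-Vec (J ∘ (false ∷_)) (p ∘ (false ∷_))))

  ∉⇒∁∈ : ∀ {J} → J ∉ sets → ∁ J ∈ sets
  ∉⇒∁∈ {J} J∉ = [ (λ J∈ → contradiction J∈ J∉) , id ]′ (ultra J)

  module _ (em : ExcludedMiddle ℓ) where

    inhabited : ∀ {J} → J ∈ sets → ∃ J
    inhabited {J} J∈ with em {∃ J}
    ... | yes p = p
    ... | no ¬p =
      contradiction (upward (λ {i} i∈J → contradiction (i , i∈J) ¬p) J∈) proper

    module _ {X : I → Setoid ℓ ℓ} (x₀ : ∀ i → Carrier (X i))
             {n} (A : Fin n → ∀ i → Subset (X i)) where

      private
        member? : ∀ i → Carrier (X i) → Fin n → Bool
        member? i y k = does (em {y ∈ pred (A k i)})

        -- The membership pattern of a point ranges over a finite set that does not depend on `i`,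
        -- so points of different carriers can be compared by it.
        type : ∀ i → Carrier (X i) → Vec Bool n
        type i y = tabulate (member? i y)

        type-cong : ∀ i {y y′} → Setoid._≈_ (X i) y y′ → type i y ≡ type i y′
        type-cong i y≈y′ = tabulate-cong λ k →
          does-⇔ (mk⇔ (respects (A k i) y≈y′)
                      (respects (A k i) (Setoid.sym (X i) y≈y′))) em em

        type-≡⇒→ : ∀ {i j y z} → type i y ≡ type j z →
                   ∀ k → y ∈ pred (A k i) → z ∈ pred (A k j)
        type-≡⇒→ {i} {j} {y} {z} eq k = does-≡⇒→ em em
          (trans (sym (lookup∘tabulate (member? i y) k))
          (trans (cong (λ σ → Vec.lookup σ k) eq)
                 (lookup∘tabulate (member? j z) k)))

        Realised : Vec Bool n → Pred I ℓ
        Realised σ i = ∃ λ y → type i y ≡ σ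

        -- The default `x₀ i` only fills coordinates that are negligible as soon as `σ` is realised
        -- almost everywhere.
        realiser : Vec Bool n → ∀ i → Carrier (X i)
        realiser σ i with em {Realised σ i}
        ... | yes (y , _) = y
        ... | no _        = x₀ i

        type-realiser : ∀ {σ i} → Realised σ i → type i (realiser σ i) ≡ σ
        type-realiser {σ} {i} r with em {Realised σ i}
        ... | yes (_ , eq) = eq
        ... | no ¬r        = contradiction r ¬r

        -- By `ultra`, a pattern is realised almost everywhere or almost nowhere; in the second case
        -- the implication is vacuous at almost every `i`.
        realised⇒sets : ∀ σ → (λ i → Realised σ i → Realised σ ∈ sets) ∈ sets
        realised⇒sets σ with ultra (Realised σ)
        ... | inj₁ r  = upward (λ _ _ → r) full
        ... | inj₂ ¬r = upward (λ i∉ i∈ → contradiction i∈ i∉) ¬r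

        embed : ∀ i → Func (X i) (Ultraproduct 𝔘 X)
        embed i = record
          { to   = realiser ∘ type i
          ; cong = Setoid.reflexive (Ultraproduct 𝔘 X) ∘ cong realiser ∘ type-cong i
          }

        -- By hypothesis almost all coordinates of the image of `y` have the pattern of `y`. For the
        -- forward inclusion, one such coordinate `j` that also lies in `A k j` suffices.
        embed-preimage : ∀ {i} → (∀ σ → Realised σ i → Realised σ ∈ sets) → ∀ k →
          pred (preimage (embed i) (ultraproductSubset 𝔘 (A k))) ≐ pred (A k i)
        embed-preimage {i} h k =
            (λ {y} p → let (j , w∈ , r) = inhabited (meet p (R y))
                       in type-≡⇒→ (type-realiser r) k w∈)
          , (λ {y} y∈ → upward (λ r → type-≡⇒→ (sym (type-realiser r)) k y∈) (R y))
          where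
          R : ∀ y → Realised (type i y) ∈ sets
          R y = h (type i y) (y , refl)

      -- A point of X i is sent to a point whose coordinates lie in the same
      -- members of the given families, wherever this is possible; almost
      -- everywhere is enough, since only finitely many combinations of
      -- memberships have to be considered.
      embedding-almost-everywhere :
        (λ i → ∃ λ (f : Func (X i) (Ultraproduct 𝔘 X)) → ∀ k →
           pred (preimage f (ultraproductSubset 𝔘 (A k))) ≐ pred (A k i)) ∈ sets
      embedding-almost-everywhere =
        upward (λ {i} h → embed i , embed-preimage h) (meet-Vec _ realised⇒sets)

    module _ {Λ : Set ℓ} (S : Structure Λ) (C : I → Coalgebra S) where

      open Structure S
      private
        open module Cᵢ i = Coalgebra (C i)

        ∏X : Setoid ℓ ℓ
        ∏X = Ultraproduct 𝔘 X

      Holds : Carrier ∏X → Λ → (∀ i → Subset (X i)) → Pred I ℓ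
      Holds x ♥ A i = (ξ i ⟨$⟩ x i) ∈ pred (⟦ ♥ ⟧ (X i) ⟨$⟩ A i)

      Holds-resp : ∀ {x y ♥ A} → Setoid._≈_ ∏X x y →
                   Holds x ♥ A ∈ sets → Holds y ♥ A ∈ sets
      Holds-resp {♥ = ♥} {A} x≈y p =
        upward (λ {i} (e , h) → respects (⟦ ♥ ⟧ (X i) ⟨$⟩ A i) (Func.cong (ξ i) e) h)
               (meet x≈y p)

      -- Families that agree almost everywhere give equal subsets of the ultraproduct, so `A` is
      -- read off from the membership proof and not from the formula.
      data Φ (x : Carrier ∏X) : Pred (OneStepFormula S ∏X) (Level.suc ℓ) where
        pos : ∀ ♥ A → Holds x ♥ A ∈ sets → Φ x (atom ♥ (ultraproductSubset 𝔘 A))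
        neg : ∀ ♥ A → Holds x ♥ A ∉ sets → Φ x (¬ᶠ atom ♥ (ultraproductSubset 𝔘 A))

      family : ∀ {x φ} → Φ x φ → ∀ i → Subset (X i)
      family (pos _ A _) = A
      family (neg _ A _) = A

      Local : ∀ {x φ} → Φ x φ → Pred I ℓ
      Local {x} (pos ♥ A _) = Holds x ♥ A
      Local {x} (neg ♥ A _) = ∁ (Holds x ♥ A)

      Local∈sets : ∀ {x φ} (l : Φ x φ) → Local l ∈ sets
      Local∈sets (pos _ _ p) = p
      Local∈sets (neg _ _ p) = ∉⇒∁∈ p

      ⟦⟧-preimage : ∀ ♥ A {i} (f : Func (X i) ∏X) →
        pred (preimage f (ultraproductSubset 𝔘 A)) ≐ pred (A i) →
        pred (preimage (T₁ f) (⟦ ♥ ⟧ ∏X ⟨$⟩ ultraproductSubset 𝔘 A)) ≐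
        pred (⟦ ♥ ⟧ (X i) ⟨$⟩ A i)
      ⟦⟧-preimage ♥ A {i} f eq =
        Setoid.trans (𝒫 (T₀ (X i)))
          {i = preimage (T₁ f) (⟦ ♥ ⟧ ∏X ⟨$⟩ ultraproductSubset 𝔘 A)}
          {j = ⟦ ♥ ⟧ (X i) ⟨$⟩ preimage f (ultraproductSubset 𝔘 A)}
          {k = ⟦ ♥ ⟧ (X i) ⟨$⟩ A i}
          (natural ♥ f (ultraproductSubset 𝔘 A))
          (Func.cong (⟦ ♥ ⟧ (X i)) eq)

      Local⇒⊨ : ∀ {x φ} (l : Φ x φ) {i} (f : Func (X i) ∏X) →
        pred (preimage f (ultraproductSubset 𝔘 (family l))) ≐ pred (family l i) →
        i ∈ Local l → _⊨_ S (T₁ f ⟨$⟩ (ξ i ⟨$⟩ x i)) φ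
      Local⇒⊨ (pos ♥ A _) f eq h   = proj₂ (⟦⟧-preimage ♥ A f eq) h
      Local⇒⊨ (neg ♥ A _) f eq h s = h (proj₁ (⟦⟧-preimage ♥ A f eq) s)

      Φ-finitely-satisfiable : (∀ i → Carrier (X i)) →
        ∀ x φs → All (_∈ Φ x) φs → Satisfiable S (_∈ᴸ φs)
      Φ-finitely-satisfiable x₀ x φs ls =
        -- Both properties hold almost everywhere, so a single index serves all positions of the
        -- list at once.
        let i , (f , eq) , h =
              inhabited (meet (embedding-almost-everywhere x₀ (family ∘ l))
                              (meet-Fin (Local ∘ l) (Local∈sets ∘ l)))
        in (T₁ f ⟨$⟩ (ξ i ⟨$⟩ x i)) , λ φ φ∈ →
          let k = index φ∈
          in subst (_⊨_ S _) (sym (lookup-index φ∈)) (Local⇒⊨ (l k) f (eq k) (h k))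
        where
        l : ∀ k → Φ x (lookup φs k)
        l k = All.lookup ls (∈-lookup k)

      satisfiable⇒quasiUltraproduct : AxiomOfChoice ℓ →
        (∀ x → Satisfiable S (Φ x)) → QuasiUltraproduct 𝔘 S C
      satisfiable⇒quasiUltraproduct choice sat = ζ , λ A x ♥ → mk⇔
          (λ s → Holds-resp (rep-≈ x) (⊨⇒Holds (rep ⟨$⟩ x) ♥ A s))
          (λ p → proj₂ (sat (rep ⟨$⟩ x)) _
                   (pos ♥ A (Holds-resp (Setoid.sym ∏X {rep ⟨$⟩ x} {x} (rep-≈ x)) p)))
        where
        -- This is the quotient map from the discrete carrier. A section sends related points to
        -- identical representatives, and on a discrete domain any choice of points respects
        -- equality.
        class : Func (setoid (Carrier ∏X)) ∏X
        class = record { to = id ; cong = Setoid.reflexive ∏X }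

        representatives = choice class (λ x → x , Setoid.refl ∏X {x})

        rep : Func ∏X (setoid (Carrier ∏X))
        rep = proj₁ representatives

        rep-≈ : ∀ x → Setoid._≈_ ∏X (rep ⟨$⟩ x) x
        rep-≈ = proj₂ representatives

        point : Func (setoid (Carrier ∏X)) (T₀ ∏X)
        point = record
          { to   = λ x → proj₁ (sat x)
          ; cong = λ { {x} refl → Setoid.refl (T₀ ∏X) {proj₁ (sat x)} }
          }

        ζ : Func ∏X (T₀ ∏X)
        ζ = Composition.function rep point

        -- Otherwise `Φ x` contains the negated atom, which the chosen point satisfies as well.
        ⊨⇒Holds : ∀ x ♥ A →
          _⊨_ S (proj₁ (sat x)) (atom ♥ (ultraproductSubset 𝔘 A)) →
          Holds x ♥ A ∈ sets
        ⊨⇒Holds x ♥ A s with em {Holds x ♥ A ∈ sets}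
        ... | yes p = p
        ... | no ¬p = contradiction s (proj₂ (sat x) _ (neg ♥ A ¬p))

theorem5p6 : ∀ {ℓ} → ExcludedMiddle ℓ → AxiomOfChoice ℓ →
    (Λ : Set ℓ) (S : Structure Λ) → OneStepCompact S → HasQuasiUltraproducts S
theorem5p6 em choice Λ S compact I C x₀ 𝔘 =
  satisfiable⇒quasiUltraproduct 𝔘 em S C choice λ x →
    compact _ (Φ 𝔘 em S C x) (Φ-finitely-satisfiable 𝔘 em S C x₀ x)
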